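{- For each gadget $G$ in the following list of four OR gadgets, the remaining gadgets in that same list can be constructed from $G$: (1) $B\cdot\cdot|\cdot BB$, (2) $\cdot B\cdot|B\cdot B$, (3) $\cdot\cdot B|BB\cdot$, and (4) $\cdots|BBB$.
   Context: Nondeterministic Constraint Logic (NCL). Edges are red (weight 1) or blue (weight 2) and are directed; each vertex has three incident edges, and the sum of weights of the edges directed into each vertex must be at least 2 (minimum inflow constraint). An OR vertex has three blue incident edges, so its constraint is: at least one of its three edges is directed into it. Gadget patterns. A gadget represents a vertex drawn as a vertical segment with three horizontal tunnels (edges) attached at three distinct heights, each leaving on the left or on the right. The pattern $x_1x_2x_3|y_1y_2y_3$ records this: for each $i\in\{1,2,3\}$ (from top to bottom) exactly one of $x_i,y_i$ is the symbol $\cdot$ and the other is a color, $B$ (blue) or $R$ (red); if $x_i$ is the color then the $i$-th tunnel leaves on the left, and if $y_i$ is the color it leaves on the right. An OR gadget is one whose three colors are all $B$ and which satisfies the constraint of an OR vertex. The mirror image of a gadget (reflection about a vertical axis) exchanges left and right, keeps heights, and is considered available whenever the gadget is. Constrained blue edge terminator. This is a component with a single blue tunnel (on the left or on the right) such that the edge represented by that tunnel is forced to be directed into the terminator; it is available for free from any OR gadget. Construction. A gadget with a given pattern "can be constructed from $G$" if there is a finite assembly as follows. Components are copies of $G$, mirror images of $G$, constrained blue edge terminators, and gadgets already constructed from $G$ in this way (and their mirror images). Components are drawn as pairwise disjoint vertical segments, of arbitrary height and with arbitrary spacing of their tunnels, respecting the top-to-bottom order and the sides in their patterns. Each tunnel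 is a horizontal segment that either joins a right tunnel entry of one component to a left tunnel entry, of the same color, of another component, or is external, i.e., extends indefinitely to the left or to the right (on its side). No other intersections or overlaps of segments occur. Exactly three tunnels are external, at distinct heights, and their sides and colors from top to bottom form the required pattern. Finally, the assembly satisfies the same constraints as an NCL OR vertex: an assignment of directions to the three external edges can be extended to directions of all internal edges satisfying the constraint of every component if and only if at least one external edge is directed into the assembly. -}

module Defs where

open import Data.Bool using (Bool; true; false; T; if_then_else_)
open import Data.Fin as Fin using (Fin; zero)
open import Data.List using (List; []; _∷_)
open import Data.Nat as ℕ using (ℕ)
open import Data.Product using (Σ; _×_; _,_; proj₁; proj₂; ∃; ∃!)
open import Data.Rational using (ℚ; _≤_; _<_)
open import Data.Sum using (_⊎_)
open import Data.Vec as Vec using (Vec; []; _∷_; lookup; tabulate)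
open import Data.Vec.Relation.Unary.All using (All)
open import Function.Bundles using (_⇔_)
open import Relation.Binary.PropositionalEquality using (_≡_; _≢_)
open import Relation.Nullary using (¬_)

data Colour : Set where
  red blue : Colour

weight : Colour → ℕ
weight red  = 1
weight blue = 2

data Side : Set where
  left right : Side

opposite : Side → Side
opposite left  = right
opposite right = left

-- One height of a pattern: the side carrying the colour; the other side is "·".
record Entry : Set where
  constructor entry
  field
    side   : Side
    colour : Colour
open Entry public

-- Entries are listed from top to bottom.
Pattern : Set
Pattern = Vec Entry 3

mirror : Pattern → Pattern
mirror = Vec.map (λ e → entry (opposite (side e)) (colour e))

AllBlue : Pattern → Set
AllBlue = All (λ e → colour e ≡ blue)

-- All tunnels are horizontal, so the direction of an edge is one of these two.
data Direction : Set where
  leftward rightward : Direction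

-- Is an edge with this direction directed into the object from whose given
-- side it leaves?
inward : Side → Direction → Bool
inward left  rightward = true
inward left  leftward  = false
inward right leftward  = true
inward right rightward = false

data Component : Set where
  gadget     : Pattern → Component
  terminator : Side → Component

arity : Component → ℕ
arity (gadget _)     = 3
arity (terminator _) = 1

entries : (k : Component) → Vec Entry (arity k)
entries (gadget P)     = P
entries (terminator s) = entry s blue ∷ []

inflow : ∀ {n} → Vec Entry n → (Fin n → Direction) → ℕ
inflow es d = Vec.sum (tabulate λ i →
  if inward (side (lookup es i)) (d i) then weight (colour (lookup es i)) else 0)

Satisfied : (k : Component) → (Fin (arity k) → Direction) → Set
Satisfied (gadget P)     d = 2 ℕ.≤ inflow P d
Satisfied (terminator s) d = T (inward s (d zero))

-- Rational coordinates lose nothing: the conditions on a drawing depend only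
-- on the order of its finitely many coordinates.
Point : Set
Point = ℚ × ℚ

record Placement (k : Component) : Set where
  field
    x bottom top : ℚ
    bottom<top   : bottom < top
    height       : Fin (arity k) → ℚ
    descending   : ∀ {i j} → i Fin.< j → height j < height i
    attached     : ∀ i → bottom ≤ height i × height i ≤ top

data Tunnel (Port : Set) : Set where
  -- from a right entry (first argument) to a left entry (second argument)
  internal : Port → Port → Tunnel Port
  external : Port → Tunnel Port

IsEnd : ∀ {Port} → Port → Tunnel Port → Set
IsEnd p (internal q r) = p ≡ q ⊎ p ≡ r
IsEnd p (external q)   = p ≡ q

-- The points of the ray leaving abscissa a on the given side.
Beyond : Side → ℚ → ℚ → Set
Beyond left  a u = u ≤ a
Beyond right a u = a ≤ u

record Arrangement : Set where
  field
    #components : ℕ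
    component   : Fin #components → Component
    placement   : ∀ c → Placement (component c)

  Port : Set
  Port = Σ (Fin #components) (λ c → Fin (arity (component c)))

  portEntry : Port → Entry
  portEntry (c , i) = lookup (entries (component c)) i

  portX portY : Port → ℚ
  portX (c , i) = Placement.x (placement c)
  portY (c , i) = Placement.height (placement c) i

  OnComponent : Fin #components → Point → Set
  OnComponent c (u , v) = u ≡ x × bottom ≤ v × v ≤ top
    where open Placement (placement c)

  OnTunnel : Tunnel Port → Point → Set
  OnTunnel (internal p q) (u , v) = portX p ≤ u × u ≤ portX q × v ≡ portY p
  OnTunnel (external p)   (u , v) =
    Beyond (side (portEntry p)) (portX p) u × v ≡ portY p

  Joins : Port → Port → Set
  Joins p q =
      side (portEntry p) ≡ right
    × side (portEntry q) ≡ left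
    × colour (portEntry p) ≡ colour (portEntry q)
    × portX p < portX q
    × portY p ≡ portY q

record Assembly : Set where
  field
    arrangement : Arrangement
  open Arrangement arrangement public
  field
    #tunnels : ℕ
    tunnel   : Fin #tunnels → Tunnel Port
    joins : ∀ {t p q} → tunnel t ≡ internal p q → Joins p q
    everyPortUsedOnce : ∀ p → ∃! _≡_ (λ t → IsEnd p (tunnel t))
    components-disjoint : ∀ {c c′} → c ≢ c′ → ∀ z →
      ¬ (OnComponent c z × OnComponent c′ z)
    tunnels-disjoint : ∀ {t t′} → t ≢ t′ → ∀ z →
      ¬ (OnTunnel (tunnel t) z × OnTunnel (tunnel t′) z)
    meet-only-at-ends : ∀ t c z → OnTunnel (tunnel t) z → OnComponent c z →
      ∃ λ i → IsEnd (c , i) (tunnel t) × z ≡ (portX (c , i) , portY (c , i))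

  tunnelAt : Port → Fin #tunnels
  tunnelAt p = proj₁ (everyPortUsedOnce p)

  Orientation : Set
  Orientation = Fin #tunnels → Direction

  Valid : Orientation → Set
  Valid o = ∀ c → Satisfied (component c) (λ i → o (tunnelAt (c , i)))

record RealisesOR (A : Assembly) (P : Pattern) : Set where
  open Assembly A
  field
    allBlue     : AllBlue P
    outer       : Fin 3 → Fin #tunnels
    outerPort   : Fin 3 → Port
    isExternal  : ∀ i → tunnel (outer i) ≡ external (outerPort i)
    noOthers    : ∀ {t p} → tunnel t ≡ external p → ∃ λ i → t ≡ outer i
    descending  : ∀ {i j} → i Fin.< j → portY (outerPort j) < portY (outerPort i)
    hasPattern  : ∀ i → portEntry (outerPort i) ≡ lookup P i
    constraint  : (e : Fin 3 → Direction) →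
      (∃ λ (o : Orientation) → (∀ i → o (outer i) ≡ e i) × Valid o)
        ⇔ (∃ λ i → T (inward (side (lookup P i)) (e i)))

mutual
  data Constructible (G : Pattern) : Pattern → Set where
    assemble : ∀ {P} (A : Assembly) →
      (∀ c → Available G (Assembly.component A c)) →
      RealisesOR A P → Constructible G P

  data Available (G : Pattern) : Component → Set where
    copy       : Available G (gadget G)
    terminate  : AllBlue G → ∀ s → Available G (terminator s)
    built      : ∀ {P} → Constructible G P → Available G (gadget P)
    mirrored   : ∀ {P} → Available G (gadget P) → Available G (gadget (mirror P))

B∣· ·∣B : Entry
B∣· = entry left blue
·∣B = entry right blue

B··∣·BB ·B·∣B·B ··B∣BB· ···∣BBB : Pattern
B··∣·BB = B∣· ∷ ·∣B ∷ ·∣B ∷ []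
·B·∣B·B = ·∣B ∷ B∣· ∷ ·∣B ∷ []
··B∣BB· = ·∣B ∷ ·∣B ∷ B∣· ∷ []
···∣BBB = ·∣B ∷ ·∣B ∷ ·∣B ∷ []

orGadgets : List Pattern
orGadgets = B··∣·BB ∷ ·B·∣B·B ∷ ··B∣BB· ∷ ···∣BBB ∷ []

{-# OPTIONS --safe #-}
-- Two OR gates joined by one edge form an OR of their four other edges, since
-- the joining edge serves exactly one of the two; a terminator discards one of
-- the four, leaving three.  Write L or R for the sides of the blue edges from
-- top to bottom.  One such tree turns LRR into RLR, one turns RLR into RRR, one
-- turns RRR into RRL and one turns RRL into LRR.  This is a cycle through the
-- four gadgets, so transitivity of constructibility gives everything.
module Submission where

open import Defs
open import Data.Bool using (T; if_then_else_)
open import Data.Bool.Properties using (T?)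
open import Data.Fin as Fin using (Fin; zero; suc; _↑ʳ_)
open import Data.Fin.Patterns using (0F; 1F; 2F)
open import Data.Fin.Properties as Fin using (all?; any?)
open import Data.Integer using (+_)
open import Data.List.Membership.Propositional using (_∈_)
open import Data.List.Relation.Unary.Any using (here; there)
open import Data.Nat as ℕ using (ℕ; zero; suc)
open import Data.Product using (_×_; _,_; ∃; uncurry)
open import Data.Product.Properties using (≡-dec)
open import Data.Rational using (ℚ; _≤_; _<_)
open import Data.Rational.Literals using (fromℤ)
open import Data.Rational.Properties as ℚ using (_≤?_; _<?_)
open import Data.Sum using ([_,_]; inj₁; inj₂)
open import Data.Unit using (⊤; tt)
open import Data.Vec as Vec using (Vec; []; _∷_; lookup; tabulate)
open import Data.Vec.Properties using (lookup-map; lookup∘tabulate; tabulate-cong)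
open import Data.Vec.Relation.Unary.All as All using (All; []; _∷_)
open import Function using (_∘_; mk⇔)
open import Relation.Binary using (DecidableEquality)
open import Relation.Binary.PropositionalEquality
  using (_≡_; _≢_; _≗_; refl; sym; trans; cong; cong₂; subst)
open import Relation.Nullary
  using (Dec; yes; no; map′; _×-dec_; _⊎-dec_; _→-dec_)
open import Relation.Nullary.Decidable using (True; toWitness)
open import Relation.Unary using (Decidable)

-- Decidability of the finite conditions.

_≟ˢ_ : DecidableEquality Side
left  ≟ˢ left  = yes refl
left  ≟ˢ right = no λ ()
right ≟ˢ left  = no λ ()
right ≟ˢ right = yes refl

_≟ᶜ_ : DecidableEquality Colour
red  ≟ᶜ red  = yes refl
red  ≟ᶜ blue = no λ ()
blue ≟ᶜ red  = no λ ()
blue ≟ᶜ blue = yes refl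

_≟ᵉ_ : DecidableEquality Entry
entry s k ≟ᵉ entry s′ k′ =
  map′ (uncurry (cong₂ entry)) (λ e → cong side e , cong colour e)
       (s ≟ˢ s′ ×-dec k ≟ᶜ k′)

_≟ᵈ_ : DecidableEquality Direction
leftward  ≟ᵈ leftward  = yes refl
leftward  ≟ᵈ rightward = no λ ()
rightward ≟ᵈ leftward  = no λ ()
rightward ≟ᵈ rightward = yes refl

-- A search over functions would reach each of them only up to `≗`. Hence orientations are
-- enumerated as vectors, and `satisfied-cong` transfers the outcome to functions.
allDirections? : ∀ {n} {P : Vec Direction n → Set} →
  Decidable P → Dec (∀ v → P v)
allDirections? {zero}  P? = map′ (λ { p [] → p }) (λ f → f []) (P? [])
allDirections? {suc n} P? = map′
  (λ { (l , r) (leftward ∷ v) → l v ; (l , r) (rightward ∷ v) → r v })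
  (λ f → f ∘ (leftward ∷_) , f ∘ (rightward ∷_))
  (allDirections? (P? ∘ (leftward ∷_)) ×-dec allDirections? (P? ∘ (rightward ∷_)))

anyDirections? : ∀ {n} {P : Vec Direction n → Set} →
  Decidable P → Dec (∃ P)
anyDirections? {zero}  P? = map′ ([] ,_) (λ { ([] , p) → p }) (P? [])
anyDirections? {suc n} P? = map′
  [ (λ (v , p) → leftward ∷ v , p) , (λ (v , p) → rightward ∷ v , p) ]
  (λ { (leftward ∷ v , p) → inj₁ (v , p) ; (rightward ∷ v , p) → inj₂ (v , p) })
  (anyDirections? (P? ∘ (leftward ∷_)) ⊎-dec anyDirections? (P? ∘ (rightward ∷_)))

satisfied-cong : ∀ k {d d′} → d ≗ d′ → Satisfied k d → Satisfied k d′
satisfied-cong (gadget P)     d≗d′ = subst (2 ℕ.≤_)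
  (cong Vec.sum (tabulate-cong λ i → cong (flow i) (d≗d′ i)))
  where
  flow : Fin 3 → Direction → ℕ
  flow i δ = if inward (side (lookup P i)) δ then weight (colour (lookup P i)) else 0
satisfied-cong (terminator s) d≗d′ = subst (T ∘ inward s) (d≗d′ zero)

satisfied? : ∀ k → Decidable (Satisfied k)
satisfied? (gadget P)     d = 2 ℕ.≤? inflow P d
satisfied? (terminator s) d = T? (inward s (d zero))

beyond? : ∀ s a u → Dec (Beyond s a u)
beyond? left  a u = u ≤? a
beyond? right a u = a ≤? u

-- Drawings whose geometry is checked by evaluation.

module _ (k : Component) (x bottom top : ℕ) (heights : Vec ℕ (arity k)) where

  private
    ⟦_⟧ : ℕ → ℚ
    ⟦ n ⟧ = fromℤ (+ n)

    height : Fin (arity k) → ℚ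
    height i = ⟦ lookup heights i ⟧

  -- Once this evaluates to `yes`, `True placeable?` is the unit type and `_` proves it. `drawable?`
  -- and `correct?` are used in the same way.
  placeable? : Dec (⟦ bottom ⟧ < ⟦ top ⟧
    × (∀ i j → i Fin.< j → height j < height i)
    × (∀ i → ⟦ bottom ⟧ ≤ height i × height i ≤ ⟦ top ⟧))
  placeable? = ⟦ bottom ⟧ <? ⟦ top ⟧
    ×-dec all? (λ i → all? λ j → i Fin.<? j →-dec height j <? height i)
    ×-dec all? (λ i → ⟦ bottom ⟧ ≤? height i ×-dec height i ≤? ⟦ top ⟧)

  place : True placeable? → Placement k
  place ok with b<t , desc , att ← toWitness ok = record
    { x = ⟦ x ⟧ ; bottom = ⟦ bottom ⟧ ; top = ⟦ top ⟧ ; bottom<top = b<t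
    ; height = height ; descending = desc _ _ ; attached = att }

module Drawing (arrangement : Arrangement) {m : ℕ}
               (tunnel : Fin m → Tunnel (Arrangement.Port arrangement)) where
  open Arrangement arrangement

  abscissa : Fin #components → ℚ
  abscissa c = Placement.x (placement c)

  altitude : Tunnel Port → ℚ
  altitude (internal p q) = portY p
  altitude (external p)   = portY p

  Joined : Tunnel Port → Set
  Joined (internal p q) = Joins p q
  Joined (external p)   = ⊤

  -- This is `∃!` with its implicit argument made explicit, so that `all?` applies.
  UsedOnce : Port → Set
  UsedOnce p = ∃ λ t → IsEnd p (tunnel t) × (∀ t′ → IsEnd p (tunnel t′) → t ≡ t′)

  -- The only point at which the tunnel can meet the component.
  crossing : Tunnel Port → Fin #components → Point
  crossing τ c = abscissa c , altitude τ

  MeetAtEnd : Tunnel Port → Fin #components → Set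
  MeetAtEnd τ c = OnTunnel τ (crossing τ c) → OnComponent c (crossing τ c) →
    ∃ λ i → IsEnd (c , i) τ

  -- Stronger than needed for disjointness, but decidable: no two components
  -- share an abscissa and no two tunnels share a height.
  Drawable : Set
  Drawable = (∀ t → Joined (tunnel t))
    × (∀ c i → UsedOnce (c , i))
    × (∀ c c′ → abscissa c ≡ abscissa c′ → c ≡ c′)
    × (∀ t t′ → altitude (tunnel t) ≡ altitude (tunnel t′) → t ≡ t′)
    × (∀ t c → MeetAtEnd (tunnel t) c)

  _≟ᵖ_ : DecidableEquality Port
  _≟ᵖ_ = ≡-dec Fin._≟_ Fin._≟_

  isEnd? : ∀ p τ → Dec (IsEnd p τ)
  isEnd? p (internal q r) = p ≟ᵖ q ⊎-dec p ≟ᵖ r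
  isEnd? p (external q)   = p ≟ᵖ q

  joined? : ∀ τ → Dec (Joined τ)
  joined? (internal p q) =
    side (portEntry p) ≟ˢ right ×-dec side (portEntry q) ≟ˢ left
    ×-dec colour (portEntry p) ≟ᶜ colour (portEntry q)
    ×-dec portX p <? portX q ×-dec portY p ℚ.≟ portY q
  joined? (external p)   = yes tt

  onTunnel? : ∀ τ z → Dec (OnTunnel τ z)
  onTunnel? (internal p q) (u , v) =
    portX p ≤? u ×-dec u ≤? portX q ×-dec v ℚ.≟ portY p
  onTunnel? (external p) (u , v) =
    beyond? (side (portEntry p)) (portX p) u ×-dec v ℚ.≟ portY p

  onComponent? : ∀ c z → Dec (OnComponent c z)
  onComponent? c (u , v) = u ℚ.≟ abscissa c
    ×-dec Placement.bottom (placement c) ≤? v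
    ×-dec v ≤? Placement.top (placement c)

  drawable? : Dec Drawable
  drawable? = all? (λ t → joined? (tunnel t))
    ×-dec all? (λ c → all? λ i → any? λ t → isEnd? (c , i) (tunnel t)
      ×-dec all? λ t′ → isEnd? (c , i) (tunnel t′) →-dec t Fin.≟ t′)
    ×-dec all? (λ c → all? λ c′ → abscissa c ℚ.≟ abscissa c′ →-dec c Fin.≟ c′)
    ×-dec all? (λ t → all? λ t′ →
      altitude (tunnel t) ℚ.≟ altitude (tunnel t′) →-dec t Fin.≟ t′)
    ×-dec all? (λ t → all? λ c →
      onTunnel? (tunnel t) (crossing (tunnel t) c)
      →-dec onComponent? c (crossing (tunnel t) c)
      →-dec any? λ i → isEnd? (c , i) (tunnel t))

  onTunnel-altitude : ∀ τ {u v} → OnTunnel τ (u , v) → v ≡ altitude τ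
  onTunnel-altitude (internal p q) (_ , _ , v≡) = v≡
  onTunnel-altitude (external p)   (_ , v≡)     = v≡

  -- An internal tunnel takes its altitude from its left end; at the right end the equality of
  -- heights has to come from `Joins`.
  end-altitude : ∀ τ p → Joined τ → IsEnd p τ → portY p ≡ altitude τ
  end-altitude (internal p q) _ _                     (inj₁ refl) = refl
  end-altitude (internal p q) _ (_ , _ , _ , _ , y≡y) (inj₂ refl) = sym y≡y
  end-altitude (external p)   _ _                     refl        = refl

  meet-at-end : ∀ τ c → Joined τ → MeetAtEnd τ c → ∀ z →
    OnTunnel τ z → OnComponent c z →
    ∃ λ i → IsEnd (c , i) τ × z ≡ (portX (c , i) , portY (c , i))
  meet-at-end τ c joined meet (u , v) onT onC@(refl , _)
    with refl ← onTunnel-altitude τ onT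
    with i , end ← meet onT onC
    = i , end , cong (_ ,_) (sym (end-altitude τ (c , i) joined end))

  draw : Drawable → Assembly
  draw (joined , once , abscissa-inj , altitude-inj , meet) = record
    { arrangement = arrangement
    ; #tunnels = m
    ; tunnel = tunnel
    ; joins = λ {t} eq → subst Joined eq (joined t)
    ; everyPortUsedOnce = λ (c , i) →
        let t , end , unique = once c i in t , end , λ {t′} → unique t′
    ; components-disjoint = λ c≢c′ _ ((u≡x , _) , (u≡x′ , _)) →
        c≢c′ (abscissa-inj _ _ (trans (sym u≡x) u≡x′))
    ; tunnels-disjoint = λ {t} {t′} t≢t′ _ (onT , onT′) →
        t≢t′ (altitude-inj _ _ (trans
          (sym (onTunnel-altitude (tunnel t) onT))
          (onTunnel-altitude (tunnel t′) onT′)))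
    ; meet-only-at-ends = λ t c z → meet-at-end (tunnel t) c (joined t) (meet t c) z
    }

-- Trees of two gadgets and a terminator.

module _ (A : Assembly) where
  open Assembly A

  valid-cong : ∀ {o o′} → o ≗ o′ → Valid o → Valid o′
  valid-cong o≗o′ valid c =
    satisfied-cong (component c) (λ i → o≗o′ (tunnelAt (c , i))) (valid c)

  valid? : Decidable Valid
  valid? o = all? λ c → satisfied? (component c) _

-- A terminator, P and Q stand in this order from left to right; i is the right
-- port of P that is joined to the left port j of Q.
module Splice
  (P Q : Pattern) (h : ℕ) (hs ks : Vec ℕ 3)
  -- A segment needs positive length, so the terminator rises one unit above its only port. All port
  -- heights chosen below are even, so no tunnel runs at height `suc h`. The gadgets end exactly at
  -- their outermost ports.
  (okT : True (placeable? (terminator right) 0 h (suc h) (h ∷ [])))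
  (okP : True (placeable? (gadget P) 1 (Vec.last hs) (Vec.head hs) hs))
  (okQ : True (placeable? (gadget Q) 2 (Vec.last ks) (Vec.head ks) ks))
  where

  arrangement : Arrangement
  arrangement = record
    { #components = 3
    ; component = lookup (terminator right ∷ gadget P ∷ gadget Q ∷ [])
    ; placement = λ where
        0F → place (terminator right) 0 h (suc h) (h ∷ []) okT
        1F → place (gadget P) 1 (Vec.last hs) (Vec.head hs) hs okP
        2F → place (gadget Q) 2 (Vec.last ks) (Vec.head ks) ks okQ
    }
  open Arrangement arrangement

  module _ (i j : Fin 3) (terminated : Port) (outerPort : Vec Port 3) where

    tunnel : Fin 5 → Tunnel Port
    -- The terminator forces tunnel `1F` leftward, so the port `terminated` receives no inflow. The
    -- external tunnels start at index 2, whence `2 ↑ʳ_` in `outer`.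
    tunnel = lookup (internal (1F , i) (2F , j)
                   ∷ internal (0F , 0F) terminated
                   ∷ Vec.map external outerPort)

    open Drawing arrangement tunnel using (drawable?; draw)

    module _ (ok : True drawable?) (H : Pattern) where

      assembly : Assembly
      assembly = draw (toWitness ok)

      open Assembly assembly using (Orientation; Valid)

      outer : Fin 3 → Fin 5
      outer = 2 ↑ʳ_

      SomeInward : (Fin 3 → Direction) → Set
      SomeInward e = ∃ λ i → T (inward (side (lookup H i)) (e i))

      Extends : (Fin 3 → Direction) → Orientation → Set
      Extends e o = (∀ i → o (outer i) ≡ e i) × Valid o

      -- The last two conditions are the two directions of `constraint`, made finite by vectors: the
      -- first runs through 32 orientations, the second seeks an extension of each of 8 outer
      -- assignments.
      Correct : Set
      Correct = All (λ e → colour e ≡ blue) H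
        × (∀ i j → i Fin.< j → portY (lookup outerPort j) < portY (lookup outerPort i))
        × (∀ i → portEntry (lookup outerPort i) ≡ lookup H i)
        × (∀ v → Valid (lookup v) → SomeInward (lookup v ∘ outer))
        × (∀ v → SomeInward (lookup v) → ∃ λ w → Extends (lookup v) (lookup w))

      correct? : Dec Correct
      correct? = All.all? (λ e → colour e ≟ᶜ blue) H
        ×-dec all? (λ i → all? λ j → i Fin.<? j →-dec _ <? _)
        ×-dec all? (λ i → _ ≟ᵉ _)
        ×-dec allDirections? (λ v →
          valid? assembly (lookup v) →-dec someInward? _)
        ×-dec allDirections? (λ v →
          someInward? _ →-dec anyDirections? λ w →
            all? (λ i → _ ≟ᵈ _) ×-dec valid? assembly (lookup w))
        where
        someInward? : Decidable SomeInward
        someInward? e = any? λ i → T? _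

      someInward-cong : ∀ {e e′} → e ≗ e′ → SomeInward e → SomeInward e′
      someInward-cong e≗e′ (i , t) = i , subst (T ∘ inward _) (e≗e′ i) t

      onlyOuter : ∀ t {p} → tunnel t ≡ external p → ∃ λ i → t ≡ outer i
      onlyOuter 0F            ()
      onlyOuter 1F            ()
      onlyOuter (suc (suc i)) _ = i , refl

      realises : Correct → RealisesOR assembly H
      realises (allBlue , descending , hasPattern , necessary , sufficient) = record
        { allBlue = allBlue
        ; outer = outer
        ; outerPort = lookup outerPort
        ; isExternal = λ i → lookup-map i external outerPort
        ; noOthers = λ {t} → onlyOuter t
        ; descending = descending _ _
        ; hasPattern = hasPattern
        ; constraint = λ e → mk⇔
            (λ (o , o≡e , valid) →
              let v≗o = lookup∘tabulate o in
              someInward-cong (λ i → trans (v≗o (outer i)) (o≡e i))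
                (necessary (tabulate o)
                  (valid-cong assembly (sym ∘ v≗o) valid)))
            (λ inw →
              let v≗e = lookup∘tabulate e
                  w , w≡v , valid =
                    sufficient (tabulate e) (someInward-cong (sym ∘ v≗e) inw)
              in lookup w , (λ i → trans (w≡v i) (v≗e i)) , valid)
        }

      splice : ∀ {G} → AllBlue G →
        Available G (gadget P) → Available G (gadget Q) →
        True correct? → Constructible G H
      splice blueG availableP availableQ correct = assemble assembly
        (λ where
          0F → terminate blueG right
          1F → availableP
          2F → availableQ)
        (realises (toWitness correct))

-- The four trees.

pattern allBlue³ = refl ∷ refl ∷ refl ∷ []

-- The top ports are joined at height 10 and the bottom left port is terminated. The other left
-- port, at 6, falls between the right ports at 8 and 4. In each of the four trees the five tunnels
-- take the heights 2, 4, 6, 8, 10 once each.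
B··∣·BB⇒·B·∣B·B : Constructible B··∣·BB ·B·∣B·B
B··∣·BB⇒·B·∣B·B = Splice.splice (mirror B··∣·BB) B··∣·BB
  2 (10 ∷ 6 ∷ 2 ∷ []) (10 ∷ 8 ∷ 4 ∷ []) _ _ _
  0F 0F (1F , 2F) ((2F , 1F) ∷ (1F , 1F) ∷ (2F , 2F) ∷ []) _ _
  allBlue³ (mirrored copy) copy _

-- The copies are staggered: the top tunnel of the left one, at 10, passes above the right one,
-- whose right ports follow at 8 and 2. The left copy's own left port is terminated.
·B·∣B·B⇒···∣BBB : Constructible ·B·∣B·B ···∣BBB
·B·∣B·B⇒···∣BBB = Splice.splice ·B·∣B·B ·B·∣B·B
  6 (10 ∷ 6 ∷ 4 ∷ []) (8 ∷ 4 ∷ 2 ∷ []) _ _ _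
  2F 1F (1F , 1F) ((1F , 0F) ∷ (2F , 0F) ∷ (2F , 2F) ∷ []) _ _
  allBlue³ copy copy _

-- The gadgets share only the height 6. The right tunnels at 10 and 8 pass over the mirrored gadget,
-- and its left tunnels at 4 and 2 pass under the copy; the one at 4 is terminated.
···∣BBB⇒··B∣BB· : Constructible ···∣BBB ··B∣BB·
···∣BBB⇒··B∣BB· = Splice.splice ···∣BBB (mirror ···∣BBB)
  4 (10 ∷ 8 ∷ 6 ∷ []) (6 ∷ 4 ∷ 2 ∷ []) _ _ _
  2F 0F (2F , 1F) ((1F , 0F) ∷ (1F , 1F) ∷ (2F , 2F) ∷ []) _ _
  allBlue³ copy (mirrored copy) _

-- Joining the bottom ports leaves left ports at 10 and 8 above right ports at 6 and 4; the one at 8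
-- is terminated.
··B∣BB·⇒B··∣·BB : Constructible ··B∣BB· B··∣·BB
··B∣BB·⇒B··∣·BB = Splice.splice (mirror ··B∣BB·) ··B∣BB·
  8 (10 ∷ 8 ∷ 2 ∷ []) (6 ∷ 4 ∷ 2 ∷ []) _ _ _
  2F 2F (1F , 1F) ((1F , 0F) ∷ (2F , 0F) ∷ (2F , 1F) ∷ []) _ _
  allBlue³ (mirrored copy) copy _

mutual
  -- No drawing changes: since built gadgets are components in their own right, each `copy` of `P`
  -- in the derivation becomes `built G⇒P`. Terminators come from `G` instead, which is why `G` must
  -- be all blue.
  constructible-trans : ∀ {G P Q} → AllBlue G →
    Constructible G P → Constructible P Q → Constructible G Q
  constructible-trans blueG G⇒P (assemble A available realises) =
    assemble A (λ c → available-trans blueG G⇒P (available c)) realises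

  available-trans : ∀ {G P k} → AllBlue G →
    Constructible G P → Available P k → Available G k
  available-trans blueG G⇒P copy          = built G⇒P
  available-trans blueG G⇒P (terminate _ s) = terminate blueG s
  available-trans blueG G⇒P (built P⇒Q)   = built (constructible-trans blueG G⇒P P⇒Q)
  available-trans blueG G⇒P (mirrored a)  = mirrored (available-trans blueG G⇒P a)

orGadget-allBlue : ∀ {G} → G ∈ orGadgets → AllBlue G
orGadget-allBlue (here refl)                         = allBlue³
orGadget-allBlue (there (here refl))                 = allBlue³
orGadget-allBlue (there (there (here refl)))         = allBlue³
orGadget-allBlue (there (there (there (here refl)))) = allBlue³

B··∣·BB⇒···∣BBB : Constructible B··∣·BB ···∣BBB
B··∣·BB⇒···∣BBB = constructible-trans allBlue³ B··∣·BB⇒·B·∣B·B ·B·∣B·B⇒···∣BBB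

B··∣·BB⇒··B∣BB· : Constructible B··∣·BB ··B∣BB·
B··∣·BB⇒··B∣BB· = constructible-trans allBlue³ B··∣·BB⇒···∣BBB ···∣BBB⇒··B∣BB·

···∣BBB⇒B··∣·BB : Constructible ···∣BBB B··∣·BB
···∣BBB⇒B··∣·BB = constructible-trans allBlue³ ···∣BBB⇒··B∣BB· ··B∣BB·⇒B··∣·BB

·B·∣B·B⇒B··∣·BB : Constructible ·B·∣B·B B··∣·BB
·B·∣B·B⇒B··∣·BB = constructible-trans allBlue³ ·B·∣B·B⇒···∣BBB ···∣BBB⇒B··∣·BB

-- `Constructible` demands an assembly, which `copy` alone does not provide; a full turn of the
-- cycle does.
B··∣·BB⇒B··∣·BB : Constructible B··∣·BB B··∣·BB
B··∣·BB⇒B··∣·BB = constructible-trans allBlue³ B··∣·BB⇒··B∣BB· ··B∣BB·⇒B··∣·BB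

-- With `B··∣·BB` as a hub, four routes out and four routes in cover all pairs.
from-B··∣·BB : ∀ {H} → H ∈ orGadgets → Constructible B··∣·BB H
from-B··∣·BB (here refl)                         = B··∣·BB⇒B··∣·BB
from-B··∣·BB (there (here refl))                 = B··∣·BB⇒·B·∣B·B
from-B··∣·BB (there (there (here refl)))         = B··∣·BB⇒··B∣BB·
from-B··∣·BB (there (there (there (here refl)))) = B··∣·BB⇒···∣BBB

to-B··∣·BB : ∀ {G} → G ∈ orGadgets → Constructible G B··∣·BB
to-B··∣·BB (here refl)                         = B··∣·BB⇒B··∣·BB
to-B··∣·BB (there (here refl))                 = ·B·∣B·B⇒B··∣·BB
to-B··∣·BB (there (there (here refl)))         = ··B∣BB·⇒B··∣·BB
to-B··∣·BB (there (there (there (here refl)))) = ···∣BBB⇒B··∣·BB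

lemma3p5 : ∀ (G H : Pattern) → G ∈ orGadgets → H ∈ orGadgets → G ≢ H → Constructible G H
lemma3p5 G H G∈ H∈ _ = constructible-trans (orGadget-allBlue G∈)
  (to-B··∣·BB G∈) (from-B··∣·BB H∈)
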